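{- Let $n \ge 4$ and let $FQ_n$, $M_0$, $M_1$, $M_2$ be as defined in the context. Let $M$ be a perfect matching of $FQ_n$ such that $M \subseteq M_0 \cup M_1 \cup M_2$ and $M \neq M_i$ for every $i \in \{0,1,2\}$. Then the graph $FQ_n - M$ (obtained by deleting the edges of $M$, keeping all vertices) is not isomorphic to the hypercube $Q_n$.
   Context: The hypercube $Q_n$ has vertex set $\{0,1\}^n$, with $x=(x_1,\dots,x_n)$ and $y$ adjacent iff they differ in exactly one coordinate. For $x \in \{0,1\}^n$ let $\overline{x}$ denote the complement of $x$, i.e. every coordinate is flipped. The folded hypercube $FQ_n$ is the graph on $\{0,1\}^n$ whose edge set consists of all edges of $Q_n$ together with all edges $\{x,\overline{x}\}$ for $x \in \{0,1\}^n$ (these are called complement edges). Define the following edge sets of $FQ_n$: $M_1$ is the set of pairs $\{x,y\}$ differing exactly in coordinate $n$; $M_2 = \{\{x,\overline{x}\} : x \in \{0,1\}^n\}$; $M_0$ is the set of pairs $\{x,y\}$ differing exactly in coordinate $n-1$. -}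

module Defs where

open import Data.Bool.Base using (Bool; not)
open import Data.Bool.Properties using (not-involutive; not-¬)
open import Data.Fin.Base using (Fin; toℕ)
open import Data.Nat.Base using (ℕ; suc; _∸_; NonZero)
open import Data.Product using (∃-syntax; ∃!; _×_; _,_)
open import Data.Sum.Base using (_⊎_; inj₁; inj₂; [_,_])
import Data.Sum.Base as Sum
open import Data.Vec.Base using (Vec; _∷_; head; lookup; map)
open import Data.Vec.Properties using (map-∘; map-cong; map-id)
open import Function.Base using (_∘_)
open import Function.Bundles using (_↔_; _⇔_; Inverse)
open import Level using (0ℓ)
open import Relation.Binary.Core using (Rel)
open import Relation.Binary.Definitions using (Symmetric)
open import Relation.Binary.PropositionalEquality using (_≡_; _≢_; refl; sym; trans; cong)
open import Relation.Nullary.Negation using (¬_)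

-- A set of unordered pairs {x,y} of distinct elements of V.
record EdgeSet (V : Set) : Set₁ where
  field
    Adj      : Rel V 0ℓ
    adj-sym  : Symmetric Adj
    loopless : ∀ {x} → ¬ Adj x x

open EdgeSet public

module _ {V : Set} where

  infix  4 _⊆_ _≐_
  infixr 6 _∪_
  infixl 6 _∖_

  _⊆_ : Rel (EdgeSet V) 0ℓ
  E ⊆ F = ∀ {x y} → Adj E x y → Adj F x y

  _≐_ : Rel (EdgeSet V) 0ℓ
  E ≐ F = (E ⊆ F) × (F ⊆ E)

  _∪_ : EdgeSet V → EdgeSet V → EdgeSet V
  E ∪ F = record
    { Adj      = λ x y → Adj E x y ⊎ Adj F x y
    ; adj-sym  = Sum.map (adj-sym E) (adj-sym F)
    ; loopless = [ loopless E , loopless F ]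
    }

  _∖_ : EdgeSet V → EdgeSet V → EdgeSet V
  E ∖ F = record
    { Adj      = λ x y → Adj E x y × ¬ Adj F x y
    ; adj-sym  = λ (e , ¬f) → adj-sym E e , ¬f ∘ adj-sym F
    ; loopless = λ (e , _) → loopless E e
    }

record Graph : Set₁ where
  field
    Vertex : Set
    edges  : EdgeSet Vertex

open Graph public

infixl 6 _-ᴱ_

_-ᴱ_ : (G : Graph) → EdgeSet (Vertex G) → Graph
G -ᴱ M = record { Vertex = Vertex G ; edges = edges G ∖ M }

record IsPerfectMatching (G : Graph) (M : EdgeSet (Vertex G)) : Set where
  field
    subset  : M ⊆ edges G
    matched : ∀ x → ∃! _≡_ (λ y → Adj M x y)

infix 4 _≅_

record _≅_ (G H : Graph) : Set where
  field
    bijection : Vertex G ↔ Vertex H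

  open Inverse bijection using (to)

  field
    adjacency : ∀ x y → Adj (edges G) x y ⇔ Adj (edges H) (to x) (to y)

BitString : ℕ → Set
BitString = Vec Bool

DifferExactlyAt : ∀ {n} → Fin n → Rel (BitString n) 0ℓ
DifferExactlyAt i x y =
  lookup x i ≢ lookup y i × (∀ j → j ≢ i → lookup x j ≡ lookup y j)

differExactlyAt-sym : ∀ {n} (i : Fin n) → Symmetric (DifferExactlyAt i)
differExactlyAt-sym i (d , s) = d ∘ sym , λ j j≢i → sym (s j j≢i)

hypercubeEdges : ∀ n → EdgeSet (BitString n)
hypercubeEdges n = record
  { Adj      = λ x y → ∃[ i ] DifferExactlyAt i x y
  ; adj-sym  = λ {x} {y} (i , p) → i , differExactlyAt-sym i {x} {y} p
  ; loopless = λ (_ , d , _) → d refl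
  }

Q : ℕ → Graph
Q n = record { Vertex = BitString n ; edges = hypercubeEdges n }

-- Coordinates are numbered 1, …, n, so i : Fin n is coordinate suc (toℕ i).
directionEdges : ∀ n (k : ℕ) → EdgeSet (BitString n)
directionEdges n k = record
  { Adj      = λ x y → ∃[ i ] (suc (toℕ i) ≡ k × DifferExactlyAt i x y)
  ; adj-sym  = λ {x} {y} (i , eq , p) → i , eq , differExactlyAt-sym i {x} {y} p
  ; loopless = λ (_ , _ , d , _) → d refl
  }

complement : ∀ {n} → BitString n → BitString n
complement = map not

complement-involutive : ∀ {n} (x : BitString n) → complement (complement x) ≡ x
complement-involutive x =
  trans (sym (map-∘ not not x)) (trans (map-cong not-involutive x) (map-id x))

complement-≢ : ∀ {n} .{{_ : NonZero n}} (x : BitString n) → x ≢ complement x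
complement-≢ (b ∷ x) eq = not-¬ refl (cong head eq)

-- For n = 0 the complement pair would be a loop.
complementEdges : ∀ n .{{_ : NonZero n}} → EdgeSet (BitString n)
complementEdges n = record
  { Adj      = λ x y → y ≡ complement x
  ; adj-sym  = λ { {x} refl → sym (complement-involutive x) }
  ; loopless = λ {x} → complement-≢ x
  }

FQ : ∀ n .{{_ : NonZero n}} → Graph
FQ n = record
  { Vertex = BitString n
  ; edges  = hypercubeEdges n ∪ complementEdges n
  }

M₀ M₁ : ∀ n → EdgeSet (BitString n)
M₀ n = directionEdges n (n ∸ 1)
M₁ n = directionEdges n n

M₂ : ∀ n .{{_ : NonZero n}} → EdgeSet (BitString n)
M₂ n = complementEdges n

{-# OPTIONS --safe #-}

-- FQ n is the Cayley graph of (ℤ/2)ⁿ on the n + 1 generators e₁, …, eₙ and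
-- their sum. The only relation among the generators is that all of them sum
-- to 0, so for n ≥ 4 two incident edges of FQ n lie in exactly one 4-cycle.
-- In Q n every two distinct incident edges lie in a 4-cycle, so the 4-cycles
-- of FQ n on two edges that survive in FQ n - M must survive too. Applied to a
-- surviving edge at x of M₀ ∪ M₁ ∪ M₂ and the edge at x in a direction
-- i ≤ n - 2, this shows that x and x + eᵢ are matched in the same class Mₖ.
-- Hence the class at x depends only on the last two bits of x, and M induces
-- a perfect matching of a K₄ whose three colour classes are the Mₖ. A perfect
-- matching of K₄ is a single colour class, so M is one of the Mₖ.

module Submission where

open import Defs
open import Data.Bool.Base using (Bool; true; false; not; _xor_)
import Data.Bool.Properties as Bool
open import Data.Bool.Solver using (module xor-∧-Solver)
open import Data.Fin.Base using (Fin; zero; suc; toℕ; fromℕ<)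
open import Data.Fin.Properties using (_≟_; all?; ¬∀⟶∃¬; pigeonhole; <⇒≢; suc-injective; toℕ-injective; toℕ-fromℕ<)
open import Data.List.Base using (List; []; _∷_; length)
open import Data.List.Membership.Propositional using (_∈_; _∉_)
open import Data.List.Membership.DecPropositional using (_∈?_)
open import Data.List.Membership.Setoid.Properties using (index-injective)
open import Data.List.Relation.Unary.Any using (here; there; index)
open import Data.Nat.Base using (ℕ; suc; _≤_; _<_; NonZero; z≤n; s≤s)
import Data.Nat.Properties as ℕ
open import Data.Product using (∃-syntax; _×_; _,_; proj₁; proj₂)
open import Data.Sum.Base using (_⊎_; inj₁; inj₂; [_,_]; map₂)
open import Data.Vec.Base using ([]; _∷_; lookup; tabulate)
open import Data.Vec.Properties using (tabulate∘lookup; lookup∘tabulate; tabulate-cong; lookup-map)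
open import Function.Base using (_∘_)
open import Function.Bundles using (_⇔_; mk⇔; Inverse; Equivalence)
open import Relation.Binary.PropositionalEquality using (_≡_; _≢_; refl; sym; trans; cong; cong₂; subst; setoid; module ≡-Reasoning)
open import Relation.Nullary.Decidable using (yes; no; does; dec-true; dec-false; does-⇔; from-yes; ¬?; _→-dec_)
open import Relation.Nullary.Negation using (¬_; contradiction)

open _≅_
open IsPerfectMatching

-- Finite index sets and bit strings.

fresh : ∀ {n} (is : List (Fin n)) → length is < n → ∃[ i ] i ∉ is
fresh {n} is is<n = ¬∀⟶∃¬ n (_∈ is) (λ i → _∈?_ _≟_ i is) λ all →
  -- If every index occurred in `is`, the positions would inject `Fin n` into a smaller set.
  let i , j , i<j , eq = pigeonhole is<n (index ∘ all)
  in <⇒≢ i<j (index-injective (setoid (Fin n)) (all i) (all j) eq)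

lookup-ext : ∀ {n} {x y : BitString n} → (∀ l → lookup x l ≡ lookup y l) → x ≡ y
lookup-ext {x = x} {y} eq =
  trans (sym (tabulate∘lookup x)) (trans (tabulate-cong eq) (tabulate∘lookup y))

-- Generators of `FQ n` and the relations among them.

δ : ∀ {n} → Fin n → Fin n → Bool
δ g l = does (g ≟ l)

δ-diag : ∀ {n} (g : Fin n) → δ g g ≡ true
δ-diag g = dec-true (g ≟ g) refl

δ-off : ∀ {n} {g l : Fin n} → g ≢ l → δ g l ≡ false
δ-off {g = g} {l} = dec-false (g ≟ l)

-- The generators of FQ n are indexed by Fin (suc n): zero is the all-ones
-- vector and suc i is the i-th unit vector; mask g is the vector itself.
mask : ∀ {n} → Fin (suc n) → Fin n → Bool
mask g l = δ g (suc l) xor δ g zero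

-- Opaque because unification can then solve for g and x in act g x.
opaque
  act : ∀ {n} → Fin (suc n) → BitString n → BitString n
  act g x = tabulate λ l → mask g l xor lookup x l

  lookup-act : ∀ {n} (g : Fin (suc n)) x l → lookup (act g x) l ≡ mask g l xor lookup x l
  lookup-act g x l = lookup∘tabulate _ l

lookup-act² : ∀ {n} (g h : Fin (suc n)) x l →
              lookup (act g (act h x)) l ≡ mask g l xor (mask h l xor lookup x l)
lookup-act² g h x l = trans (lookup-act g (act h x) l) (cong (mask g l xor_) (lookup-act h x l))

act-comm : ∀ {n} (g h : Fin (suc n)) x → act g (act h x) ≡ act h (act g x)
act-comm g h x = lookup-ext λ l → begin
  lookup (act g (act h x)) l               ≡⟨ lookup-act² g h x l ⟩
  mask g l xor (mask h l xor lookup x l)   ≡⟨ solve 3 (λ a b c → a :+ (b :+ c) := b :+ (a :+ c)) refl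
                                                (mask g l) (mask h l) (lookup x l) ⟩
  mask h l xor (mask g l xor lookup x l)   ≡⟨ lookup-act² h g x l ⟨
  lookup (act h (act g x)) l               ∎
  where
  open ≡-Reasoning
  open xor-∧-Solver

act-involutive : ∀ {n} (g : Fin (suc n)) x → act g (act g x) ≡ x
act-involutive g x = lookup-ext λ l →
  trans (lookup-act² g g x l) (solve 2 (λ a c → a :+ (a :+ c) := c) refl (mask g l) (lookup x l))
  where
  open xor-∧-Solver

-- S l is the coefficient of the generator l in the relation h + s + h′ + g = 0
-- asserted by the hypothesis; the only nontrivial relation is the sum of all
-- generators, and it involves more than four of them.
act²-cancel : ∀ {n} → 4 ≤ n → (h s h′ g : Fin (suc n)) (x : BitString n) →
              act h (act s x) ≡ act h′ (act g x) → s ≢ g → h ≡ s ⊎ h ≡ g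
act²-cancel {n} 4≤n h s h′ g x eq s≢g with h ≟ s | h ≟ g
... | yes h≡s | _       = inj₁ h≡s
... | no _    | yes h≡g = inj₂ h≡g
... | no h≢s  | no h≢g  = contradiction (trans (sym S-s) (S-false s)) λ ()
  where
  S : Fin (suc n) → Bool
  S l = (δ h l xor δ s l) xor (δ h′ l xor δ g l)

  -- Adding both sides of `eq` at bit `l` cancels `lookup x l` and leaves `S (suc l) xor S zero`.
  S-suc : ∀ l → S (suc l) ≡ S zero
  S-suc l = begin
    S (suc l)                    ≡⟨ solve 9 (λ A B C D a b c d x →
                                  ((A :+ B) :+ (C :+ D)) :=
                                  (((A :+ a) :+ ((B :+ b) :+ x)) :+ ((C :+ c) :+ ((D :+ d) :+ x)))
                                    :+ ((a :+ b) :+ (c :+ d)))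
                                  refl (δ h (suc l)) (δ s (suc l)) (δ h′ (suc l)) (δ g (suc l))
                                       (δ h zero) (δ s zero) (δ h′ zero) (δ g zero) (lookup x l) ⟩
    (left xor right) xor S zero  ≡⟨ cong (λ b → (b xor right) xor S zero) left≡right ⟩
    (right xor right) xor S zero ≡⟨ cong (_xor S zero) (Bool.xor-same right) ⟩
    S zero                       ∎
    where
    open ≡-Reasoning
    open xor-∧-Solver
    left right : Bool
    left  = mask h l xor (mask s l xor lookup x l)
    right = mask h′ l xor (mask g l xor lookup x l)
    left≡right : left ≡ right
    left≡right = trans (sym (lookup-act² h s x l))
                       (trans (cong (λ y → lookup y l) eq) (lookup-act² h′ g x l))

  S-const : ∀ l → S l ≡ S zero
  S-const zero    = refl
  S-const (suc l) = S-suc l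

  -- The constant value of `S` is read off at a generator `t` outside the four; there are at least
  -- five generators.
  S-false : ∀ l → S l ≡ false
  S-false l with t , t∉ ← fresh (h ∷ s ∷ h′ ∷ g ∷ []) (s≤s 4≤n) = begin
    S l    ≡⟨ S-const l ⟩
    S zero ≡⟨ S-const t ⟨
    S t    ≡⟨ cong₂ _xor_
                (cong₂ _xor_ (δ-off (t∉ ∘ here ∘ sym)) (δ-off (t∉ ∘ there ∘ here ∘ sym)))
                (cong₂ _xor_ (δ-off (t∉ ∘ there ∘ there ∘ here ∘ sym))
                             (δ-off (t∉ ∘ there ∘ there ∘ there ∘ here ∘ sym))) ⟩
    false  ∎
    where
    open ≡-Reasoning

  -- As `h` differs from `s` and `g`, only `h′` can cancel its coefficient.
  h′≡h : h′ ≡ h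
  h′≡h with h′ ≟ h
  ... | yes p = p
  ... | no h′≢h = contradiction (trans (sym S-h) (S-false h)) λ ()
    where
    S-h : S h ≡ true
    S-h = cong₂ _xor_ (cong₂ _xor_ (δ-diag h) (δ-off (h≢s ∘ sym)))
                      (cong₂ _xor_ (δ-off h′≢h) (δ-off (h≢g ∘ sym)))

  -- Once `h` and `h′` coincide, nothing cancels the coefficient of `s`.
  S-s : S s ≡ true
  S-s = cong₂ _xor_ (cong₂ _xor_ (δ-off h≢s) (δ-diag s))
                    (cong₂ _xor_ (δ-off (h≢s ∘ trans (sym h′≡h))) (δ-off (s≢g ∘ sym)))

-- Applying a further generator `t` to both sides gives a relation for `act²-cancel`; choosing `t`
-- away from `g` and `h` contradicts its conclusion.
act-injective : ∀ {n} → 4 ≤ n → ∀ {g h : Fin (suc n)} {x : BitString n} → act g x ≡ act h x → g ≡ h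
act-injective 4≤n {g} {h} {x} eq with g ≟ h
... | yes g≡h = g≡h
... | no g≢h with t , t∉ ← fresh (g ∷ h ∷ []) (s≤s (ℕ.≤-trans (s≤s (s≤s z≤n)) 4≤n)) =
  contradiction (act²-cancel 4≤n t g t h x (cong (act t) eq) g≢h)
                [ t∉ ∘ here , t∉ ∘ there ∘ here ]

-- Edges as generators.

complement≡act : ∀ {n} (x : BitString n) → complement x ≡ act zero x
complement≡act x = lookup-ext λ l → trans (lookup-map l not x) (sym (lookup-act zero x l))

differ⇒act : ∀ {n} {i : Fin n} x y → DifferExactlyAt i x y → y ≡ act (suc i) x
differ⇒act {i = i} x y (d , s) = lookup-ext λ l → trans (bit l) (sym (lookup-act (suc i) x l))
  where
  bit : ∀ l → lookup y l ≡ mask (suc i) l xor lookup x l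
  bit l with i ≟ l
  ... | yes refl = Bool.¬-not (d ∘ sym)
  ... | no i≢l   = sym (s l (i≢l ∘ sym))

act⇒differ : ∀ {n} (i : Fin n) x → DifferExactlyAt i x (act (suc i) x)
act⇒differ i x = (λ eq → Bool.not-¬ refl (trans eq atᵢ)) , λ j j≢i → sym (off j (j≢i ∘ sym))
  where
  atᵢ : lookup (act (suc i) x) i ≡ not (lookup x i)
  atᵢ = trans (lookup-act (suc i) x i) (cong (λ b → (b xor false) xor lookup x i) (δ-diag i))
  off : ∀ j → i ≢ j → lookup (act (suc i) x) j ≡ lookup x j
  off j i≢j = trans (lookup-act (suc i) x j) (cong (λ b → (b xor false) xor lookup x j) (δ-off i≢j))

FQ-adj⇒act : ∀ {n} .{{_ : NonZero n}} x y → Adj (edges (FQ n)) x y → ∃[ g ] y ≡ act g x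
FQ-adj⇒act x y (inj₁ (i , d)) = suc i , differ⇒act x y d
FQ-adj⇒act x y (inj₂ eq)      = zero , trans eq (complement≡act x)

FQ-act : ∀ {n} .{{_ : NonZero n}} g x → Adj (edges (FQ n)) x (act g x)
FQ-act zero    x = inj₂ (sym (complement≡act x))
FQ-act (suc i) x = inj₁ (i , act⇒differ i x)

directionEdges-⇔ : ∀ {n k} (i : Fin n) → suc (toℕ i) ≡ k → ∀ x y →
                   Adj (directionEdges n k) x y ⇔ (y ≡ act (suc i) x)
directionEdges-⇔ i i≡k x y = mk⇔
  (λ { (j , j≡k , d) → trans (differ⇒act x y d)
         (cong (λ i → act (suc i) x) (toℕ-injective (ℕ.suc-injective (trans j≡k (sym i≡k))))) })
  (λ { refl → i , i≡k , act⇒differ i x })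

-- Squares on incident edges.

-- Looplessness keeps adjacent vertices apart, so `x`, `y`, `w`, `z` form a genuine 4-cycle. This is
-- the isomorphism invariant that the proof tests.
IncidentEdgesInSquare : Graph → Set
IncidentEdgesInSquare G = ∀ {x y z} → Adj (edges G) x y → Adj (edges G) x z → y ≢ z →
  ∃[ w ] (w ≢ x × Adj (edges G) y w × Adj (edges G) z w)

-- The fourth corner is `x` with bits `i` and `j` both flipped; were it `x` itself, `y` and `z`
-- would coincide.
Q-incidentEdgesInSquare : ∀ n → IncidentEdgesInSquare (Q n)
Q-incidentEdgesInSquare n {x} {y} {z} (i , xy) (j , xz) y≢z =
  act (suc j) y , w≢x , (j , act⇒differ j y) , (i , subst (DifferExactlyAt i z) (sym w≡) (act⇒differ i z))
  where
  w≡ : act (suc j) y ≡ act (suc i) z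
  w≡ = trans (cong (act (suc j)) (differ⇒act x y xy))
             (trans (act-comm (suc j) (suc i) x) (cong (act (suc i)) (sym (differ⇒act x z xz))))
  w≢x : act (suc j) y ≢ x
  w≢x eq = y≢z (trans (sym (act-involutive (suc j) y)) (trans (cong (act (suc j)) eq) (sym (differ⇒act x z xz))))

≅-incidentEdgesInSquare : ∀ {G H} → G ≅ H → IncidentEdgesInSquare H → IncidentEdgesInSquare G
≅-incidentEdgesInSquare {G} {H} φ squares {x} {y} {z} xy xz y≢z =
  let w , w≢x , yw , zw = squares (Equivalence.to (adjacency φ x y) xy)
                                  (Equivalence.to (adjacency φ x z) xz)
                                  (y≢z ∘ to-injective)
  in from w , (λ eq → w≢x (trans (sym (strictlyInverseˡ w)) (cong to eq))) , pull yw , pull zw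
  where
  open Inverse (bijection φ) using (to; from; strictlyInverseˡ; strictlyInverseʳ)
  to-injective : ∀ {u v} → to u ≡ to v → u ≡ v
  to-injective {u} {v} eq =
    trans (sym (strictlyInverseʳ u)) (trans (cong from eq) (strictlyInverseʳ v))
  pull : ∀ {u w} → Adj (edges H) (to u) w → Adj (edges G) u (from w)
  pull {u} {w} uw = Equivalence.from (adjacency φ u (from w))
    (subst (Adj (edges H) (to u)) (sym (strictlyInverseˡ w)) uw)

-- Functions invariant under bit flips.

InvariantAt : ∀ {n} {A : Set} → (BitString n → A) → Fin n → Set
InvariantAt f l = ∀ x y → DifferExactlyAt l x y → f x ≡ f y

-- Turn `x` into `y` one bit at a time: each bit that really changes is one at which `f` is
-- invariant.
invariant⇒≡ : ∀ {n} {A : Set} (f : BitString n → A) x y →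
              (∀ l → lookup x l ≡ lookup y l ⊎ InvariantAt f l) → f x ≡ f y
invariant⇒≡ f []      []      _ = refl
invariant⇒≡ f (a ∷ x) (b ∷ y) H = trans tails heads
  where
  prepend : ∀ l {x y : BitString _} → DifferExactlyAt l x y → DifferExactlyAt (suc l) (a ∷ x) (a ∷ y)
  prepend l (d , s) = d , λ { zero _ → refl ; (suc j) j≢l → s j (j≢l ∘ cong suc) }

  tails : f (a ∷ x) ≡ f (a ∷ y)
  tails = invariant⇒≡ (f ∘ (a ∷_)) x y λ l → map₂ (λ inv x y d → inv _ _ (prepend l {x} {y} d)) (H (suc l))

  heads : f (a ∷ y) ≡ f (b ∷ y)
  heads with H zero | a Bool.≟ b
  ... | inj₁ a≡b | _       = cong (λ c → f (c ∷ y)) a≡b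
  ... | inj₂ inv | yes a≡b = cong (λ c → f (c ∷ y)) a≡b
  ... | inj₂ inv | no a≢b  = inv _ _ (a≢b , λ { zero 0≢0 → contradiction refl 0≢0 ; (suc _) _ → refl })

-- The matching as a colouring by three classes.

-- The nonzero elements of the Klein four-group, seen as the masks of
-- 0, 1, 2 : Fin 3: the sum of any two of them is the third.
klein : ∀ (k g k′ j : Fin 3) → k ≢ g → g ≢ k′ → k ≢ k′ →
        (δ k′ j xor δ k′ zero) xor (δ g j xor δ g zero) ≡ δ k j xor δ k zero
klein = from-yes (all? {3} λ k → all? {3} λ g → all? {3} λ k′ → all? {3} λ j →
  ¬? (k ≟ g) →-dec ¬? (g ≟ k′) →-dec ¬? (k ≟ k′) →-dec
  ((δ k′ j xor δ k′ zero) xor (δ g j xor δ g zero)) Bool.≟ (δ k j xor δ k zero))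

module _ {n : ℕ} (p q : Fin n) where

  -- With p and q the last two coordinates, these are the generators of M₂, M₀, M₁.
  class : Fin 3 → Fin (suc n)
  class zero             = zero
  class (suc zero)       = suc p
  class (suc (suc zero)) = suc q

  module _ (p≢q : p ≢ q) where

    class-injective : ∀ k l → class k ≡ class l → k ≡ l
    class-injective zero             zero             _  = refl
    class-injective zero             (suc zero)       ()
    class-injective zero             (suc (suc zero)) ()
    class-injective (suc zero)       (suc zero)       _  = refl
    class-injective (suc (suc zero)) (suc (suc zero)) _  = refl
    class-injective (suc zero)       (suc (suc zero)) eq = contradiction (suc-injective eq) p≢q
    class-injective (suc (suc zero)) (suc zero)       eq = contradiction (sym (suc-injective eq)) p≢q

    δ-class : ∀ k l → δ (class k) (class l) ≡ δ k l
    δ-class k l = does-⇔ (mk⇔ (class-injective k l) (cong class)) (class k ≟ class l) (k ≟ l)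

    -- The matching is encoded by `colour`, the class of the matching edge at each vertex.
    module _ .{{_ : NonZero n}} (4≤n : 4 ≤ n) {M : EdgeSet (BitString n)}
             (squares : IncidentEdgesInSquare (FQ n -ᴱ M))
             (colour  : BitString n → Fin 3)
             (partner : ∀ x y → Adj M x y ⇔ (y ≡ act (class (colour x)) x)) where

      matched⇒colour : ∀ k x → Adj M x (act (class k) x) → k ≡ colour x
      matched⇒colour k x m =
        class-injective k (colour x) (act-injective 4≤n (Equivalence.to (partner x _) m))

      colour⇒matched : ∀ x → Adj M x (act (class (colour x)) x)
      colour⇒matched x = Equivalence.from (partner x _) refl

      -- Generators are involutions, so a matching edge has the same class seen from either end.
      colour-partner : ∀ x → colour (act (class (colour x)) x) ≡ colour x
      colour-partner x = sym (matched⇒colour (colour x) _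
        (subst (Adj M _) (sym (act-involutive _ x)) (adj-sym M (colour⇒matched x))))

      -- Two surviving edges at `x` span a surviving square. By `act²-cancel` its edge at `act s x`
      -- has generator `s` or `g`, and `s` would lead back to `x`.
      square-closes : ∀ {s g} x → s ≢ g → ¬ Adj M x (act s x) → ¬ Adj M x (act g x) →
                      ¬ Adj M (act s x) (act g (act s x))
      square-closes {s} {g} x s≢g x∤s x∤g
        with w , w≢x , (sw , s∤w) , (gw , _) ←
               squares (FQ-act s x , x∤s) (FQ-act g x , x∤g) (s≢g ∘ act-injective 4≤n)
        with h , refl ← FQ-adj⇒act (act s x) w sw
        with h′ , eq ← FQ-adj⇒act (act g x) (act h (act s x)) gw
        with act²-cancel 4≤n h s h′ g x eq s≢g
      ... | inj₁ refl = contradiction (act-involutive s x) w≢x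
      ... | inj₂ refl = s∤w

      -- If the colours differed, the class matched at the far end would survive at `x`, as does the
      -- edge in direction `l`, which is in no class. Then `square-closes` makes the far matching
      -- edge survive too.
      colour-invariant : ∀ l → l ≢ p → l ≢ q → InvariantAt colour l
      colour-invariant l l≢p l≢q x y d with refl ← differ⇒act x y d
        with colour (act (suc l) x) ≟ colour x
      ... | yes eq = sym eq
      ... | no neq = contradiction (colour⇒matched (act (suc l) x))
        (square-closes x (l∉class _) (λ m → l∉class _ (act-injective 4≤n (Equivalence.to (partner x _) m)))
                                     (neq ∘ matched⇒colour _ x))
        where
        l∉class : ∀ k → suc l ≢ class k
        l∉class zero             ()
        l∉class (suc zero)       eq = l≢p (suc-injective eq)
        l∉class (suc (suc zero)) eq = l≢q (suc-injective eq)

      -- The two vertices agree at `p` and `q` by `klein`, and `colour` is invariant at all other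
      -- coordinates.
      colour-third : ∀ {k g k′} x → k ≢ g → g ≢ k′ → k ≢ k′ →
                     colour (act (class k′) (act (class g) x)) ≡ colour (act (class k) x)
      colour-third {k} {g} {k′} x k≢g g≢k′ k≢k′ = invariant⇒≡ colour _ _ agree
        where
        agree-class : ∀ j {l} → suc l ≡ class j →
                      lookup (act (class k′) (act (class g) x)) l ≡ lookup (act (class k) x) l
        agree-class j {l} l≡j = begin
          lookup (act (class k′) (act (class g) x)) l                ≡⟨ lookup-act² (class k′) (class g) x l ⟩
          mask (class k′) l xor (mask (class g) l xor lookup x l)    ≡⟨ Bool.xor-assoc (mask (class k′) l) _ _ ⟨
          (mask (class k′) l xor mask (class g) l) xor lookup x l    ≡⟨ cong (_xor lookup x l) masks ⟩
          mask (class k) l xor lookup x l                            ≡⟨ lookup-act (class k) x l ⟨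
          lookup (act (class k) x) l                                 ∎
          where
          open ≡-Reasoning
          mask-class : ∀ k → mask (class k) l ≡ δ k j xor δ k zero
          mask-class k = cong₂ _xor_ (trans (cong (δ (class k)) l≡j) (δ-class k j)) (δ-class k zero)
          masks : mask (class k′) l xor mask (class g) l ≡ mask (class k) l
          masks = trans (cong₂ _xor_ (mask-class k′) (mask-class g))
                        (trans (klein k g k′ j k≢g g≢k′ k≢k′) (sym (mask-class k)))

        agree : ∀ l → lookup (act (class k′) (act (class g) x)) l ≡ lookup (act (class k) x) l
                      ⊎ InvariantAt colour l
        agree l with l ≟ p | l ≟ q
        ... | yes l≡p | _       = inj₁ (agree-class (suc zero) (cong suc l≡p))
        ... | no _    | yes l≡q = inj₁ (agree-class (suc (suc zero)) (cong suc l≡q))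
        ... | no l≢p  | no l≢q  = inj₂ (colour-invariant l l≢p l≢q)

      -- This is the K₄ argument: if neither end is matched along `g` and the colours differ, the
      -- partners of both ends are the same vertex of K₄, so the colours agree after all.
      colour-act-class : ∀ g x → colour (act (class g) x) ≡ colour x
      colour-act-class g x
        with colour x ≟ g | g ≟ colour (act (class g) x) | colour x ≟ colour (act (class g) x)
      ... | yes refl | _        | _       = colour-partner x
      ... | no _     | _        | yes eq  = sym eq
      -- The `g`-edge is the matching edge at `y`, hence also at `x`.
      ... | no k≢g   | yes g≡k′ | no _    = contradiction g≡colour (k≢g ∘ sym)
        where
        g≡colour : g ≡ colour x
        g≡colour = trans g≡k′ (begin
          colour y                          ≡⟨ colour-partner y ⟨
          colour (act (class (colour y)) y) ≡⟨ cong (λ k → colour (act (class k) y)) g≡k′ ⟨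
          colour (act (class g) y)          ≡⟨ cong colour (act-involutive (class g) x) ⟩
          colour x                          ∎)
          where
          open ≡-Reasoning
          y = act (class g) x
      ... | no k≢g   | no g≢k′  | no k≢k′ = begin
        colour y                          ≡⟨ colour-partner y ⟨
        colour (act (class (colour y)) y) ≡⟨ colour-third x k≢g g≢k′ k≢k′ ⟩
        colour (act (class (colour x)) x) ≡⟨ colour-partner x ⟩
        colour x                          ∎
        where
        open ≡-Reasoning
        y = act (class g) x

      colour-constant : ∀ x y → colour x ≡ colour y
      colour-constant x y = invariant⇒≡ colour x y λ l → inj₂ (invariant l)
        where
        invariant : ∀ l → InvariantAt colour l
        invariant l x y d with l ≟ p | l ≟ q
        ... | yes refl | _        = sym (trans (cong colour (differ⇒act x y d)) (colour-act-class (suc zero) x))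
        ... | no _     | yes refl = sym (trans (cong colour (differ⇒act x y d)) (colour-act-class (suc (suc zero)) x))
        ... | no l≢p   | no l≢q   = colour-invariant l l≢p l≢q x y d

      M≐class : ∀ {k} z → colour z ≡ k → (N : EdgeSet (BitString n)) →
                (∀ x y → Adj N x y ⇔ (y ≡ act (class k) x)) → M ≐ N
      M≐class {k} z z≡k N N⇔ =
        (λ {x} {y} m → Equivalence.from (N⇔ x y) (trans (Equivalence.to (partner x y) m) (recolour x))) ,
        (λ {x} {y} e → Equivalence.from (partner x y) (trans (Equivalence.to (N⇔ x y) e) (sym (recolour x))))
        where
        recolour : ∀ x → act (class (colour x)) x ≡ act (class k) x
        recolour x = cong (λ k → act (class k) x) (trans (colour-constant x z) z≡k)

-- The colouring of a given matching.

theorem2 : (n : ℕ) .{{_ : NonZero n}} → 4 ≤ n →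
    (M : EdgeSet (BitString n)) →
    IsPerfectMatching (FQ n) M →
    M ⊆ M₀ n ∪ M₁ n ∪ M₂ n →
    ¬ (M ≐ M₀ n) → ¬ (M ≐ M₁ n) → ¬ (M ≐ M₂ n) →
    ¬ (FQ n -ᴱ M ≅ Q n)
theorem2 1 (s≤s ())
theorem2 n@(suc (suc m)) 4≤n M perfect M⊆ M≢M₀ M≢M₁ M≢M₂ φ = excluded (colour z) refl
  where
  squares : IncidentEdgesInSquare (FQ n -ᴱ M)
  squares = ≅-incidentEdgesInSquare φ (Q-incidentEdgesInSquare n)

  m<n : m < n
  m<n = ℕ.m≤n+m (suc m) 1

  -- The zero-based positions `m` and `suc m` are coordinates `n - 1` and `n`.
  p q : Fin n
  p = fromℕ< m<n
  q = fromℕ< (ℕ.n<1+n (suc m))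

  p≡m : toℕ p ≡ m
  p≡m = toℕ-fromℕ< m<n

  q≡1+m : toℕ q ≡ suc m
  q≡1+m = toℕ-fromℕ< (ℕ.n<1+n (suc m))

  p≢q : p ≢ q
  p≢q eq = ℕ.1+n≢n (trans (sym q≡1+m) (trans (cong toℕ (sym eq)) p≡m))

  M₀⇔ : ∀ x y → Adj (M₀ n) x y ⇔ (y ≡ act (suc p) x)
  M₀⇔ = directionEdges-⇔ p (cong suc p≡m)

  M₁⇔ : ∀ x y → Adj (M₁ n) x y ⇔ (y ≡ act (suc q) x)
  M₁⇔ = directionEdges-⇔ q (cong suc q≡1+m)

  M₂⇔ : ∀ x y → Adj (M₂ n) x y ⇔ (y ≡ act zero x)
  M₂⇔ x y = mk⇔ (λ eq → trans eq (complement≡act x)) (λ eq → trans eq (sym (complement≡act x)))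

  classify : ∀ x y → Adj M x y → ∃[ k ] y ≡ act (class p q k) x
  classify x y e with M⊆ e
  ... | inj₁ e₀        = suc zero , Equivalence.to (M₀⇔ x y) e₀
  ... | inj₂ (inj₁ e₁) = suc (suc zero) , Equivalence.to (M₁⇔ x y) e₁
  ... | inj₂ (inj₂ e₂) = zero , Equivalence.to (M₂⇔ x y) e₂

  colour : BitString n → Fin 3
  colour x = let y , e , _ = matched perfect x in proj₁ (classify x y e)

  partner : ∀ x y → Adj M x y ⇔ (y ≡ act (class p q (colour x)) x)
  partner x y =
    let y′ , e , unique = matched perfect x
        mate≡ = proj₂ (classify x y′ e)
    in mk⇔ (λ m → trans (sym (unique m)) mate≡)
           (λ y≡ → subst (Adj M x) (trans mate≡ (sym y≡)) e)

  ≐class : ∀ {k} z → colour z ≡ k → (N : EdgeSet (BitString n)) →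
           (∀ x y → Adj N x y ⇔ (y ≡ act (class p q k) x)) → M ≐ N
  ≐class = M≐class p q p≢q 4≤n {M} squares colour partner

  -- Any vertex serves: `colour` is constant, so its value here tells which class `M` is.
  z : BitString n
  z = tabulate λ _ → false

  excluded : ∀ k → colour z ≢ k
  excluded zero             eq = M≢M₂ (≐class z eq (M₂ n) M₂⇔)
  excluded (suc zero)       eq = M≢M₀ (≐class z eq (M₀ n) M₀⇔)
  excluded (suc (suc zero)) eq = M≢M₁ (≐class z eq (M₁ n) M₁⇔)
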